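{- Let $n$ be a reachable node of a negotiation diagram $\mathcal N$. If $\mathcal N$ is a sound deterministic negotiation diagram, then so is $\mathcal N|_n$.
   Context: A negotiation diagram $\mathcal N$ is a tuple $(\mathrm{Proc},N,\mathrm{dom},R,\delta)$: $\mathrm{Proc}$ is a finite set of processes, $N$ a finite set of nodes, $\mathrm{dom}(n)\subseteq \mathrm{Proc}$ is a nonempty set for every node $n$, $R$ is a set of outcomes, each node $n$ has a set $\mathrm{out}(n)\subseteq R$ of outcomes, and for every $n\in N$, $a\in \mathrm{out}(n)$, $p\in\mathrm{dom}(n)$ a set $\delta(n,a,p)\subseteq N$ is given such that $p\in\mathrm{dom}(n')$ for all $n'\in\delta(n,a,p)$. There are two distinguished nodes, the initial node $n_{init}$ and the final node $n_{fin}$, with $\mathrm{dom}(n_{init})=\mathrm{dom}(n_{fin})=\mathrm{Proc}$. Every node, except for $n_{fin}$, has at least one outcome. $\mathcal N$ is deterministic if every $\delta(n,a,p)$ is a singleton or empty; singletons $\{n'\}$ are then identified with $n'$. A location is a pair $\ell=(n,a)$ with $a\in\mathrm{out}(n)$; its domain is $\mathrm{dom}(n)$. A configuration is a map $C:\mathrm{Proc}\to\mathcal P(N)$. A node $n$ is enabled in $C$ if $n\in C(p)$ for all $p\in\mathrm{dom}(n)$. If $n$ is enabled in $C$ and $a\in \mathrm{out}(n)$ then $C\xrightarrow{(n,a)}C'$, where $C'(p)=\delta(n,a,p)$ for $p\in\mathrm{dom}(n)$ and $C'(p)=C(p)$ otherwise. A run from $C$ is a sequence $w$ of locations that can be executed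 successively from $C$; write $C\xrightarrow{w}C'$ if $w$ is finite and leads from $C$ to $C'$. $C_{init}(p)=\{n_{init}\}$ and $C_{fin}(p)=\{n_{fin}\}$ for all $p$. A run is successful if it starts in $C_{init}$ and ends in $C_{fin}$. $\mathcal N$ is sound if every finite run from $C_{init}$ can be completed to a successful run. A configuration is reachable if it is reachable from $C_{init}$ by a finite run; a node is reachable if it is enabled at some reachable configuration. An $n$-sequence is a finite sequence of locations whose domains are all included in $\mathrm{dom}(n)$. For a reachable node $n$ of a sound deterministic $\mathcal N$: $I(n)$ is the unique reachable configuration enabling $n$ and no other node; $F(n)$ is the unique configuration reachable from $I(n)$ by an $n$-sequence such that for every node $m$ enabled at $F(n)$, $\mathrm{dom}(m)$ is not included in $\mathrm{dom}(n)$. The negotiation diagram $\mathcal N|_n$ has process set $\mathrm{dom}(n)$; it contains all the nodes and locations that appear in the $n$-sequences $u$ such that $I(n)\xrightarrow{u}F(n)$, plus a new final node $n|_n^{fin}$ with domain $\mathrm{dom}(n)$. Its initial node is $n$, and its transition function is $\delta|_n(m,a,p)=\delta(m,a,p)$ if $\delta(m,a,p)\ne F(n)(p)$, and $\delta|_n(m,a,p)=n|_n^{fin}$ if $\delta(m,a,p)=F(n)(p)$. -}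

module Defs where

open import Data.Bool.Base using (if_then_else_)
open import Data.Bool.Properties using () renaming (_≟_ to _≟ᵇ_)
open import Data.Empty using (⊥)
open import Data.Fin.Base using (Fin; zero; suc)
open import Data.Fin.Subset using (Subset; outside; ⁅_⁆; Nonempty; _∈_; _∉_; _⊆_; _⊈_)
  renaming (⊥ to ∅)
open import Data.List.Base using (List; []; _∷_; _++_)
open import Data.List.Membership.Propositional using () renaming (_∈_ to _∈ˡ_)
open import Data.List.Relation.Unary.All using (All)
open import Data.Nat.Base using (ℕ; suc)
open import Data.Product.Base using (∃; _×_; _,_; proj₁; proj₂)
open import Data.Sum.Base using (_⊎_)
open import Data.Unit.Base using (⊤)
open import Data.Vec.Base using (_∷_)
open import Data.Vec.Properties using (≡-dec)
open import Level using (0ℓ)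
open import Relation.Binary.Definitions using (DecidableEquality)
open import Relation.Binary.PropositionalEquality using (_≡_; _≢_)
open import Relation.Nullary.Decidable using (does)
open import Relation.Unary using (Pred)

-- The finite sets of processes and nodes are subsets of ambient sets Fin P
-- and Fin K, so that restricting a diagram only shrinks these subsets.  Node
-- and Out are arbitrary predicates: R need not be finite, so it may be
-- undecidable whether a node or a location occurs in a suitable run, which is
-- what defines the nodes and outcomes of a restricted diagram.
-- Values of dom, Out and δ at arguments that are not nodes, outcomes or
-- processes of the domain are irrelevant.
record Diagram (P K : ℕ) (R : Set) : Set₁ where
  field
    Proc : Subset P
    Node : Pred (Fin K) 0ℓ
    dom  : Fin K → Subset P
    Out  : Fin K → Pred R 0ℓ
    δ    : Fin K → R → Fin P → Subset K
    init : Fin K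
    fin  : Fin K

module _ {P K : ℕ} {R : Set} (𝓝 : Diagram P K R) where
  open Diagram 𝓝

  record IsNegotiation : Set where
    field
      init-node    : Node init
      fin-node     : Node fin
      dom-init     : dom init ≡ Proc
      dom-fin      : dom fin ≡ Proc
      dom⊆Proc     : ∀ n → Node n → dom n ⊆ Proc
      dom-nonempty : ∀ n → Node n → Nonempty (dom n)
      has-outcome  : ∀ n → Node n → n ≢ fin → ∃ λ a → Out n a
      δ-valid      : ∀ n a p → Node n → Out n a → p ∈ dom n →
                     ∀ n′ → n′ ∈ δ n a p → Node n′ × p ∈ dom n′

  Deterministic : Set
  Deterministic = ∀ n a p → Node n → Out n a → p ∈ dom n →
                  (δ n a p ≡ ∅) ⊎ (∃ λ n′ → δ n a p ≡ ⁅ n′ ⁆)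

  Location : Set
  Location = Fin K × R

  -- Only the values at processes in Proc matter, hence the equality _≐_.
  Config : Set
  Config = Fin P → Subset K

  _≐_ : Config → Config → Set
  C ≐ C′ = ∀ p → p ∈ Proc → C p ≡ C′ p

  Enabled : Config → Fin K → Set
  Enabled C n = Node n × (∀ p → p ∈ dom n → n ∈ C p)

  record Step (C : Config) (ℓ : Location) (C′ : Config) : Set where
    n = proj₁ ℓ
    a = proj₂ ℓ
    field
      enabled : Enabled C n
      outcome : Out n a
      moved   : ∀ p → p ∈ dom n → C′ p ≡ δ n a p
      kept    : ∀ p → p ∈ Proc → p ∉ dom n → C′ p ≡ C p

  data Run : Config → List Location → Config → Set where
    []  : ∀ {C C′} → C ≐ C′ → Run C [] C′
    _∷_ : ∀ {C ℓ C′ w C″} → Step C ℓ C′ → Run C′ w C″ → Run C (ℓ ∷ w) C″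

  C-init : Config
  C-init _ = ⁅ init ⁆

  C-fin : Config
  C-fin _ = ⁅ fin ⁆

  Sound : Set
  Sound = ∀ w C → Run C-init w C → ∃ λ w′ → Run C-init (w ++ w′) C-fin

  Reachable : Config → Set
  Reachable C = ∃ λ w → Run C-init w C

  ReachableNode : Fin K → Set
  ReachableNode n = ∃ λ C → Reachable C × Enabled C n

  NSequence : Fin K → List Location → Set
  NSequence n = All (λ ℓ → dom (proj₁ ℓ) ⊆ dom n)

  -- I is I(n).
  record IsI (n : Fin K) (I : Config) : Set where
    field
      reachable : Reachable I
      enables-n : Enabled I n
      only-n    : ∀ m → Enabled I m → m ≡ n

  -- F is F(n), computed from I = I(n).  The node fin is enabled in C-fin and
  -- has domain Proc, so if it were not disregarded in maximal, F(n) would not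
  -- exist when dom n ≡ Proc, whereas F(init) is meant to be C-fin.  It is not
  -- disregarded for n ≡ fin: F(fin) does not exist.
  record IsF (n : Fin K) (I F : Config) : Set where
    field
      reached : ∃ λ u → NSequence n u × Run I u F
      maximal : ∀ m → Enabled F m → (m ≢ fin) ⊎ (n ≡ fin) → dom m ⊈ dom n

  Appears : Fin K → Config → Config → Location → Set
  Appears n I F ℓ = ∃ λ u → NSequence n u × Run I u F × ℓ ∈ˡ u

_≟ˢ_ : ∀ {K} → DecidableEquality (Subset K)
_≟ˢ_ = ≡-dec _≟ᵇ_

-- 𝓝|ₙ for I = I(n) and F = F(n): zero is the new final node and suc m is the
-- node m of 𝓝.
restrict : ∀ {P K R} (𝓝 : Diagram P K R) (n : Fin K) (I F : Config 𝓝) →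
           Diagram P (suc K) R
restrict {P} {K} {R} 𝓝 n I F = record
  { Proc = dom n
  ; Node = Node|
  ; dom  = dom|
  ; Out  = Out|
  ; δ    = δ|
  ; init = suc n
  ; fin  = zero
  }
  where
  open Diagram 𝓝

  Node| : Fin (suc K) → Set
  Node| zero    = ⊤
  Node| (suc m) = ∃ λ a → Appears 𝓝 n I F (m , a)

  dom| : Fin (suc K) → Subset P
  dom| zero    = dom n
  dom| (suc m) = dom m

  Out| : Fin (suc K) → R → Set
  Out| zero    a = ⊥
  Out| (suc m) a = Appears 𝓝 n I F (m , a)

  δ| : Fin (suc K) → R → Fin P → Subset (suc K)
  δ| zero    a p = ∅
  δ| (suc m) a p =
    if does (δ m a p ≟ˢ F p) then ⁅ zero ⁆ else outside ∷ δ m a p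

{-# OPTIONS --safe #-}
module Submission where

-- The key fact is a uniqueness principle: two reachable configurations F and C
-- coincide as soon as every node enabled in one of them has a process on which
-- they agree.  To see this, concatenate completions of C and F into one list L
-- of locations; every successor of an entry is fin or occurs further down L.
-- Walk down L in both configurations, skipping the entries whose node occurs
-- again later.  When y is the head, a process waiting at y can never be joined
-- at y by a process that is elsewhere, so by soundness an occupied y is enabled;
-- as F and C agree on a process of y, it is enabled in both or occupied in
-- neither.  Firing the same outcome on both sides preserves the agreement, and
-- L ends in the final configuration for both; processes that differ never move.
--
-- Consequently every run from I(n) by an n-sequence (an n-run) extends to F(n).
-- It follows that F(n)(p) is not fired in an n-run, unless it is fin: otherwise
-- the nodes that p leaves in n-runs would be closed under successors, so p could
-- never reach fin.  Hence redirecting F(n)(p) to the new final node turns n-runs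
-- into runs of 𝓝|ₙ and back.

open import Defs
open import Data.Bool.Base using (if_then_else_)
open import Data.Fin.Base using (Fin; zero; suc)
open import Data.Fin.Properties using (any?; all?; _≟_)
open import Data.Fin.Subset using (Subset; outside; ⁅_⁆; _∈_; _∉_; _⊆_; _⊈_)
  renaming (⊥ to ∅)
open import Data.Fin.Subset.Properties
  using (_∈?_; _⊆?_; ∉⊥; x∈⁅x⁆; x∈⁅y⁆⇒x≡y)
open import Data.List.Base using (List; []; _∷_; _++_)
open import Data.List.Membership.Propositional using () renaming (_∈_ to _∈ˡ_)
open import Data.List.Membership.Propositional.Properties using (∈-++⁺ˡ; ∈-++⁺ʳ)
open import Data.List.Relation.Unary.All as All using (All; []; _∷_)
open import Data.List.Relation.Unary.All.Properties using (++⁺)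
open import Data.List.Relation.Unary.Any as Any using (Any; here; there)
open import Data.Nat.Base using (ℕ; suc)
open import Data.Product.Base using (∃; ∃₂; _×_; _,_; proj₁; proj₂)
open import Data.Sum.Base as Sum using (_⊎_; inj₁; inj₂)
open import Data.Unit.Base using (tt) renaming (⊤ to Unit)
open import Data.Vec.Base using (here; there; _∷_)
open import Relation.Binary.PropositionalEquality
  using (_≡_; _≢_; refl; sym; trans; cong; subst)
open import Relation.Nullary.Decidable
  using (Dec; yes; no; does; map′; _×-dec_; _→-dec_; ¬?; decidable-stable)
open import Relation.Nullary.Negation using (¬_; contradiction)

-- Finite subsets and occurrences in words.

⊈⇒witness : ∀ {k} {S T : Subset k} → S ⊈ T → ∃ λ q → q ∈ S × q ∉ T
⊈⇒witness {S = S} {T} S⊈T with any? (λ q → (q ∈? S) ×-dec ¬? (q ∈? T))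
... | yes w = w
... | no ¬w = contradiction
  (λ {q} q∈S → decidable-stable (q ∈? T) (λ q∉T → ¬w (q , q∈S , q∉T))) S⊈T

∈-singleton : ∀ {k} {S : Subset k} {x y} → S ≡ ⁅ y ⁆ → x ∈ S → x ≡ y
∈-singleton refl x∈ = x∈⁅y⁆⇒x≡y _ x∈

singleton-∋ : ∀ {k} {S : Subset k} {x} → S ≡ ⁅ x ⁆ → x ∈ S
singleton-∋ refl = x∈⁅x⁆ _

Occurs : {A B : Set} → A → List (A × B) → Set
Occurs x w = ∃ λ b → (x , b) ∈ˡ w

occurs-there : ∀ {A B : Set} {x : A} {ℓ} {w : List (A × B)} → Occurs x w → Occurs x (ℓ ∷ w)
occurs-there (b , x∈) = b , there x∈

occurs? : ∀ {k} {B : Set} (x : Fin k) (w : List (Fin k × B)) → Dec (Occurs x w)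
occurs? x w = map′ from-any (λ (_ , ∈w) → Any.map (cong proj₁) ∈w) (Any.any? (λ ℓ → x ≟ proj₁ ℓ) w)
  where
  from-any : ∀ {w} → Any (λ ℓ → x ≡ proj₁ ℓ) w → Occurs x w
  from-any (here refl) = _ , here refl
  from-any (there i)   = occurs-there (from-any i)

-- Runs of an arbitrary negotiation diagram.

module Runs {P K : ℕ} {R : Set} (𝓝 : Diagram P K R) (negotiation : IsNegotiation 𝓝) where
  open Diagram 𝓝
  open IsNegotiation negotiation
  open Step using (enabled; outcome; moved; kept)

  private
    variable
      A B C C′ C″ D E : Config 𝓝
      ℓ : Location 𝓝
      w w′ : List (Location 𝓝)

  ≐-sym : _≐_ 𝓝 C C′ → _≐_ 𝓝 C′ C
  ≐-sym e p p∈ = sym (e p p∈)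

  ≐-trans : _≐_ 𝓝 C C′ → _≐_ 𝓝 C′ C″ → _≐_ 𝓝 C C″
  ≐-trans e f p p∈ = trans (e p p∈) (f p p∈)

  step-source : _≐_ 𝓝 C C′ → Step 𝓝 C′ ℓ D → Step 𝓝 C ℓ D
  step-source {ℓ = x , a} e s = record
    { enabled = proj₁ (enabled s) , λ p p∈ →
        subst (x ∈_) (sym (e p (dom⊆Proc x (proj₁ (enabled s)) p∈))) (proj₂ (enabled s) p p∈)
    ; outcome = outcome s
    ; moved   = moved s
    ; kept    = λ p p∈ p∉ → trans (kept s p p∈ p∉) (sym (e p p∈))
    }

  run-source : _≐_ 𝓝 C C′ → Run 𝓝 C′ w D → Run 𝓝 C w D
  run-source e ([] f)  = [] (≐-trans e f)
  run-source e (s ∷ r) = step-source e s ∷ r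

  run-target : Run 𝓝 C w D → _≐_ 𝓝 D E → Run 𝓝 C w E
  run-target ([] e)  f = [] (≐-trans e f)
  run-target (s ∷ r) f = s ∷ run-target r f

  infixr 5 _++ʳ_
  _++ʳ_ : Run 𝓝 C w D → Run 𝓝 D w′ E → Run 𝓝 C (w ++ w′) E
  [] e    ++ʳ t = run-source e t
  (s ∷ r) ++ʳ t = s ∷ (r ++ʳ t)

  single : Step 𝓝 C ℓ D → Run 𝓝 C (ℓ ∷ []) D
  single s = s ∷ [] (λ _ _ → refl)

  step-functional : _≐_ 𝓝 A B → Step 𝓝 A ℓ C → Step 𝓝 B ℓ D → _≐_ 𝓝 C D
  step-functional {ℓ = x , _} e s t p p∈ with p ∈? dom x
  ... | yes p∈x = trans (moved s p p∈x) (sym (moved t p p∈x))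
  ... | no  p∉x = trans (kept s p p∈ p∉x) (trans (e p p∈) (sym (kept t p p∈ p∉x)))

  -- A location determines the next configuration up to `_≐_`, so both runs agree after `w`. As
  -- `Sound` speaks only of runs from `C-init`, this is what turns it into completions of reachable
  -- configurations.
  run-cancelˡ : _≐_ 𝓝 A B → Run 𝓝 A w C → Run 𝓝 B (w ++ w′) D → Run 𝓝 C w′ D
  run-cancelˡ e ([] f)  t       = run-source (≐-sym (≐-trans (≐-sym e) f)) t
  run-cancelˡ e (s ∷ r) (t ∷ u) = run-cancelˡ (step-functional e s t) r u

  unmoved : ∀ {p} → p ∈ Proc → All (λ ℓ → p ∉ dom (proj₁ ℓ)) w → Run 𝓝 C w D → C p ≡ D p
  unmoved p∈ []         ([] e)  = e _ p∈
  unmoved p∈ (p∉ ∷ p∉w) (s ∷ r) = trans (sym (kept s _ p∈ p∉)) (unmoved p∈ p∉w r)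

  -- The first location that moves `p` is enabled, so its node lies in `C p` and must be `z`.
  left⇒occurs : ∀ {p z} → p ∈ Proc → C p ≡ ⁅ z ⁆ → D p ≢ ⁅ z ⁆ → Run 𝓝 C w D → Occurs z w
  left⇒occurs p∈ eq ne ([] e) = contradiction (trans (sym (e _ p∈)) eq) ne
  left⇒occurs {w = (x , a) ∷ _} {p = p} p∈ eq ne (s ∷ r) with p ∈? dom x
  ... | yes p∈x = a , here (cong (_, a) (sym (∈-singleton eq (proj₂ (enabled s) p p∈x))))
  ... | no  p∉x = occurs-there (left⇒occurs p∈ (trans (kept s p p∈ p∉x) eq) ne r)

  fire : ∀ {x a} → Enabled 𝓝 C x → Out x a → ∃ λ D → Step 𝓝 C (x , a) D
  fire {C = C} {x} {a} en o = C⁺ , record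
    { enabled = en ; outcome = o ; moved = C⁺-in ; kept = λ p _ → C⁺-out p }
    where
    C⁺ : Config 𝓝
    C⁺ p with p ∈? dom x
    ... | yes _ = δ x a p
    ... | no  _ = C p
    C⁺-in : ∀ p → p ∈ dom x → C⁺ p ≡ δ x a p
    C⁺-in p p∈ with p ∈? dom x
    ... | yes _ = refl
    ... | no ¬p = contradiction p∈ ¬p
    C⁺-out : ∀ p → p ∉ dom x → C⁺ p ≡ C p
    C⁺-out p p∉ with p ∈? dom x
    ... | yes p∈ = contradiction p∈ p∉
    ... | no _   = refl

  enabled? : ∀ C {x} → Node x → Dec (Enabled 𝓝 C x)
  enabled? C {x} nx = map′ (nx ,_) proj₂ (all? (λ p → (p ∈? dom x) →-dec (x ∈? C p)))

-- Positions of processes in reachable configurations.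

module SoundDeterministic {P K : ℕ} {R : Set} (𝓝 : Diagram P K R)
  (negotiation : IsNegotiation 𝓝) (deterministic : Deterministic 𝓝) (sound : Sound 𝓝) where
  open Diagram 𝓝
  open IsNegotiation negotiation
  open Runs 𝓝 negotiation public
  open Step using (enabled; outcome; moved; kept)

  private
    variable
      C D F G : Config 𝓝
      w L : List (Location 𝓝)

  reachable-run : Reachable 𝓝 C → Run 𝓝 C w D → Reachable 𝓝 D
  reachable-run (u , r) t = _ , r ++ʳ t

  reachable-step : ∀ {ℓ} → Reachable 𝓝 C → Step 𝓝 C ℓ D → Reachable 𝓝 D
  reachable-step rc s = reachable-run rc (single s)

  completion : Reachable 𝓝 C → ∃ λ w → Run 𝓝 C w (C-fin 𝓝)
  completion (u , r) = let w , t = sound u _ r in w , run-cancelˡ (λ _ _ → refl) r t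

  At : Config 𝓝 → Fin P → Fin K → Set
  At C p z = C p ≡ ⁅ z ⁆ × Node z × p ∈ dom z

  At-or-nowhere : Config 𝓝 → Set
  At-or-nowhere C = ∀ p → p ∈ Proc → C p ≡ ∅ ⊎ ∃ (At C p)

  run-At-or-nowhere : At-or-nowhere C → Run 𝓝 C w D → At-or-nowhere D
  run-At-or-nowhere h ([] e) p p∈ with h p p∈
  ... | inj₁ eq            = inj₁ (trans (sym (e p p∈)) eq)
  ... | inj₂ (z , eq , nz) = inj₂ (z , trans (sym (e p p∈)) eq , nz)
  run-At-or-nowhere {C = C} {w = (x , a) ∷ _} h (_∷_ {C′ = C′} s r) = run-At-or-nowhere h′ r
    where
    h′ : At-or-nowhere C′
    h′ p p∈ with p ∈? dom x
    ... | no p∉x with h p p∈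
    ...   | inj₁ eq            = inj₁ (trans (kept s p p∈ p∉x) eq)
    ...   | inj₂ (z , eq , nz) = inj₂ (z , trans (kept s p p∈ p∉x) eq , nz)
    h′ p p∈ | yes p∈x with deterministic x a p (proj₁ (enabled s)) (outcome s) p∈x
    ...   | inj₁ eq       = inj₁ (trans (moved s p p∈x) eq)
    ...   | inj₂ (z , eq) = inj₂ (z , trans (moved s p p∈x) eq ,
              δ-valid x a p (proj₁ (enabled s)) (outcome s) p∈x z (singleton-∋ eq))

  nowhere-forever : ∀ {p} → p ∈ Proc → C p ≡ ∅ → Run 𝓝 C w D → D p ≡ ∅
  nowhere-forever p∈ eq ([] e) = trans (sym (e _ p∈)) eq
  nowhere-forever {w = (x , a) ∷ _} {p = p} p∈ eq (s ∷ r) with p ∈? dom x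
  ... | yes p∈x = contradiction (subst (x ∈_) eq (proj₂ (enabled s) p p∈x)) ∉⊥
  ... | no  p∉x = nowhere-forever p∈ (trans (kept s p p∈ p∉x) eq) r

  -- Determinism leaves singletons and the empty set. A process with an empty set takes part in no
  -- further step, so `C-fin` would be out of reach, against soundness.
  located : Reachable 𝓝 C → ∀ p → p ∈ Proc → ∃ (At C p)
  located rc@(u , r) p p∈ with run-At-or-nowhere init-located r p p∈
    where
    init-located : At-or-nowhere (C-init 𝓝)
    init-located p p∈ = inj₂ (init , refl , init-node , subst (p ∈_) (sym dom-init) p∈)
  ... | inj₂ at = at
  ... | inj₁ eq = contradiction
    (subst (fin ∈_) (nowhere-forever p∈ eq (proj₂ (completion rc))) (x∈⁅x⁆ fin)) ∉⊥

  at : Reachable 𝓝 C → ∀ {p z} → p ∈ Proc → z ∈ C p → At C p z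
  at {C} rc {p} p∈ z∈ with located rc p p∈
  ... | y , eq , ny = subst (At C p) (sym (∈-singleton eq z∈)) (eq , ny)

  enabled-at : Reachable 𝓝 C → ∀ {x p} → Enabled 𝓝 C x → p ∈ dom x → C p ≡ ⁅ x ⁆
  enabled-at rc en p∈ = proj₁ (at rc (dom⊆Proc _ (proj₁ en) p∈) (proj₂ en _ p∈))

  fin-enabled⇒C-fin : Reachable 𝓝 C → Enabled 𝓝 C fin → _≐_ 𝓝 C (C-fin 𝓝)
  fin-enabled⇒C-fin rc en p p∈ = enabled-at rc en (subst (p ∈_) (sym dom-fin) p∈)

  -- fin may have outcomes, so a completion may pass through fin.
  fin-free-completion : Reachable 𝓝 C →
    ∃ λ w → Run 𝓝 C w (C-fin 𝓝) × All (λ ℓ → proj₁ ℓ ≢ fin) w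
  fin-free-completion rc = truncate rc (proj₂ (completion rc))
    where
    truncate : Reachable 𝓝 D → Run 𝓝 D w (C-fin 𝓝) →
      ∃ λ w → Run 𝓝 D w (C-fin 𝓝) × All (λ ℓ → proj₁ ℓ ≢ fin) w
    truncate rd ([] e) = [] , [] e , []
    truncate {w = (x , a) ∷ _} rd (s ∷ r) with x ≟ fin
    ... | yes refl = [] , [] (fin-enabled⇒C-fin rd (enabled s)) , []
    ... | no x≢fin =
      let w , t , ≢fin = truncate (reachable-step rd s) r
      in  (x , a) ∷ w , s ∷ t , x≢fin ∷ ≢fin

  -- The first location of a completion avoiding `fin` would be enabled, so that completion is
  -- empty.
  deadlock-free : Reachable 𝓝 C → (∀ z → z ≢ fin → ¬ Enabled 𝓝 C z) → _≐_ 𝓝 C (C-fin 𝓝)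
  deadlock-free rc dead with fin-free-completion rc
  ... | _ , [] e , _ = e
  ... | _ , s ∷ _ , ≢fin ∷ _ = contradiction (enabled s) (dead _ ≢fin)

  -- Closing lists of locations and greedy firing.

  record Leads (x : Fin K) (a : R) (L : List (Location 𝓝)) : Set where
    field
      node     : Node x
      nonfinal : x ≢ fin
      outcome  : Out x a
      target   : ∀ p → p ∈ dom x → ∀ z → z ∈ δ x a p → z ≡ fin ⊎ Occurs z L

  -- Unlike a run, such a list is not tied to a configuration, so completions of different
  -- configurations can be concatenated.
  data Closing : List (Location 𝓝) → Set where
    []  : Closing []
    _∷_ : ∀ {x a L} → Leads x a L → Closing L → Closing ((x , a) ∷ L)

  closing-nonfinal : ∀ {ℓ} → Closing L → ℓ ∈ˡ L → proj₁ ℓ ≢ fin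
  closing-nonfinal (l ∷ _) (here refl) = Leads.nonfinal l
  closing-nonfinal (_ ∷ c) (there ∈L)  = closing-nonfinal c ∈L

  closing-++ : ∀ {L M} → Closing L → Closing M → Closing (L ++ M)
  closing-++ []      d = d
  closing-++ {M = M} (l ∷ c) d = record { Leads l ; target = target } ∷ closing-++ c d
    where
    target : ∀ p → p ∈ dom _ → ∀ z → z ∈ δ _ _ p → z ≡ fin ⊎ Occurs z (_ ++ M)
    target p p∈ z z∈ with Leads.target l p p∈ z z∈
    ... | inj₁ eq       = inj₁ eq
    ... | inj₂ (b , ∈L) = inj₂ (b , ∈-++⁺ˡ ∈L)

  Covers : List (Location 𝓝) → Config 𝓝 → Set
  Covers L C = ∀ p → p ∈ Proc → ∀ z → z ∈ C p → z ≡ fin ⊎ Occurs z L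

  completion-covers : Reachable 𝓝 C → Run 𝓝 C w (C-fin 𝓝) → Covers w C
  completion-covers rc r p p∈ z z∈ with z ≟ fin
  ... | yes eq = inj₁ eq
  ... | no  ne = inj₂ (left⇒occurs p∈ (proj₁ (at rc p∈ z∈))
                  (λ eq → ne (∈-singleton (sym eq) (x∈⁅x⁆ z))) r)

  -- After each step the rest of the word is a completion of the new configuration, so every
  -- non-final node just entered is fired in it.
  completion-closing : Reachable 𝓝 C → Run 𝓝 C w (C-fin 𝓝) →
    All (λ ℓ → proj₁ ℓ ≢ fin) w → Closing w
  completion-closing rc ([] _) [] = []
  completion-closing {w = (x , a) ∷ w} rc (s ∷ r) (≢fin ∷ ≢fins) = record
    { node     = proj₁ (enabled s)
    ; nonfinal = ≢fin
    ; outcome  = outcome s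
    ; target   = λ p p∈ z z∈ →
        completion-covers rc′ r p (dom⊆Proc x (proj₁ (enabled s)) p∈) z
          (subst (z ∈_) (sym (moved s p p∈)) z∈)
    } ∷ completion-closing rc′ r ≢fins
    where rc′ = reachable-step rc s

  -- One scan of `L` suffices. A node enabled after firing `x` either shares a process with `x`, and
  -- is then one of its targets and occurs in the rest, or was enabled before. With `A` trivial the
  -- scan ends in a deadlock; with domains inside `dom n` it leads to F(n).
  greedy : {A : Fin K → Set} → (∀ z → Dec (A z)) → Closing L → Reachable 𝓝 C →
    (∀ z → z ≢ fin → A z → Enabled 𝓝 C z → Occurs z L) →
    ∃₂ λ v D → Run 𝓝 C v D × All (λ ℓ → A (proj₁ ℓ) × ℓ ∈ˡ L) v ×
      (∀ z → z ≢ fin → A z → ¬ Enabled 𝓝 D z)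
  greedy {C = C} A? [] rc h =
    [] , C , [] (λ _ _ → refl) , [] , λ z ≢fin az en → contradiction (proj₂ (h z ≢fin az en)) λ ()
  greedy {L = (x , a) ∷ L} {C} {A} A? (l ∷ c) rc h with A? x ×-dec enabled? C (Leads.node l)
  ... | no ¬ax =
    let v , D , r , ∈L , stop = greedy A? c rc h′
    in  v , D , r , All.map (λ (az , ∈L) → az , there ∈L) ∈L , stop
    where
    h′ : ∀ z → z ≢ fin → A z → Enabled 𝓝 C z → Occurs z L
    h′ z ≢fin az en with h z ≢fin az en
    ... | b , here refl = contradiction (az , en) ¬ax
    ... | b , there ∈L  = b , ∈L
  ... | yes (ax , en) =
    let v , D , r , ∈L , stop = greedy A? c (reachable-step rc s) h′
    in  (x , a) ∷ v , D , s ∷ r , (ax , here refl) ∷ All.map (λ (az , ∈L) → az , there ∈L) ∈L , stop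
    where
    fired = fire en (Leads.outcome l)
    C′ = proj₁ fired
    s = proj₂ fired
    h′ : ∀ z → z ≢ fin → A z → Enabled 𝓝 C′ z → Occurs z L
    h′ z ≢fin az en′ with any? (λ p → (p ∈? dom z) ×-dec (p ∈? dom x))
    ... | yes (p , p∈z , p∈x)
        with Leads.target l p p∈x z (subst (z ∈_) (moved s p p∈x) (proj₂ en′ p p∈z))
    ...   | inj₁ eq = contradiction eq ≢fin
    ...   | inj₂ o  = o
    h′ z ≢fin az en′ | no disjoint
        with h z ≢fin az (proj₁ en′ , λ p p∈z →
               subst (z ∈_) (kept s p (dom⊆Proc z (proj₁ en′) p∈z) (λ p∈x → disjoint (p , p∈z , p∈x)))
                 (proj₂ en′ p p∈z))
    ...   | b , there ∈L  = b , ∈L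
    ...   | b , here refl =
      let p , p∈ = dom-nonempty z (proj₁ en′) in contradiction (p , p∈ , p∈) disjoint

  stays : ∀ {p y} → p ∈ Proc → C p ≡ ⁅ y ⁆ → ¬ Occurs y w → Run 𝓝 C w D → D p ≡ ⁅ y ⁆
  stays {D = D} {p} {y} p∈ eq ¬o r =
    decidable-stable (D p ≟ˢ ⁅ y ⁆) (λ ne → ¬o (left⇒occurs p∈ eq ne r))

  -- Otherwise firing what L allows ends in a deadlock in which p still waits at y.
  occupied⇒enabled : ∀ {p y a} → Reachable 𝓝 C → Closing ((y , a) ∷ L) → ¬ Occurs y L →
    Covers ((y , a) ∷ L) C → p ∈ Proc → y ∈ C p → Enabled 𝓝 C y
  occupied⇒enabled {C = C} {L} {p} {y} rc (l ∷ c) y∉L cov p∈ y∈ =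
    decidable-stable (enabled? C (Leads.node l)) λ ¬en →
      let v , D , r , v∈L , stop = greedy (λ _ → yes tt) c rc (others ¬en)
          rd  = reachable-run rc r
          y∉v = λ (b , ∈v) → y∉L (b , proj₂ (All.lookup v∈L ∈v))
          y∈D = stays p∈ (proj₁ (at rc p∈ y∈)) y∉v r
          fin∈D = deadlock-free rd (λ z ≢fin → stop z ≢fin tt) p p∈
      in  Leads.nonfinal l (∈-singleton fin∈D (singleton-∋ y∈D))
    where
    others : ¬ Enabled 𝓝 C y → ∀ z → z ≢ fin → Unit → Enabled 𝓝 C z → Occurs z L
    others ¬en z ≢fin _ en with dom-nonempty z (proj₁ en)
    ... | q , q∈ with cov q (dom⊆Proc z (proj₁ en) q∈) z (proj₂ en q q∈)
    ...   | inj₁ eq              = contradiction eq ≢fin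
    ...   | inj₂ (_ , here refl) = contradiction en ¬en
    ...   | inj₂ (b , there ∈L)  = b , ∈L

  -- Uniqueness of reachable configurations.

  AgreeOnEnabled : Config 𝓝 → Config 𝓝 → Set
  AgreeOnEnabled F G = ∀ z → z ≢ fin → Enabled 𝓝 F z → ∃ λ q → q ∈ dom z × F q ≡ G q

  -- If `z` meets `dom x`, a shared process has just been sent to the same place on both sides.
  -- Otherwise no process of `z` moved, and the earlier agreement persists.
  agree-step : ∀ {F′ G′ ℓ} → AgreeOnEnabled F G → Step 𝓝 F ℓ F′ → Step 𝓝 G ℓ G′ →
    AgreeOnEnabled F′ G′
  agree-step {ℓ = x , a} h s t z ≢fin en with any? (λ q → (q ∈? dom z) ×-dec (q ∈? dom x))
  ... | yes (q , q∈z , q∈x) = q , q∈z , trans (moved s q q∈x) (sym (moved t q q∈x))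
  ... | no disjoint = q , q∈z , trans (F≡ q q∈z) (trans eq (sym (G≡ q q∈z)))
    where
    module _ (p : Fin P) (p∈z : p ∈ dom z) where
      p∈ = dom⊆Proc z (proj₁ en) p∈z
      p∉ = λ p∈x → disjoint (p , p∈z , p∈x)
      F≡ = kept s p p∈ p∉
      G≡ = kept t p p∈ p∉
    back = h z ≢fin (proj₁ en , λ p p∈z → subst (z ∈_) (F≡ p p∈z) (proj₂ en p p∈z))
    q   = proj₁ back
    q∈z = proj₁ (proj₂ back)
    eq  = proj₂ (proj₂ back)

  covers-step : ∀ {x a} → Reachable 𝓝 C → Leads x a L → Step 𝓝 C (x , a) D →
    Covers ((x , a) ∷ L) C → Covers L D
  covers-step {x = x} rc l s cov p p∈ z z∈ with p ∈? dom x
  ... | yes p∈x = Leads.target l p p∈x z (subst (z ∈_) (moved s p p∈x) z∈)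
  ... | no  p∉x with z∈C ← subst (z ∈_) (kept s p p∈ p∉x) z∈ | cov p p∈ z z∈C
  ...   | inj₁ eq              = inj₁ eq
  ...   | inj₂ (_ , here refl) = contradiction (proj₂ (proj₂ (at rc p∈ z∈C))) p∉x
  ...   | inj₂ (b , there ∈L)  = inj₂ (b , ∈L)

  covers-tail : ∀ {x a} → (∀ p → p ∈ Proc → x ∈ C p → Occurs x L) →
    Covers ((x , a) ∷ L) C → Covers L C
  covers-tail h cov p p∈ z z∈ with cov p p∈ z z∈
  ... | inj₁ eq              = inj₁ eq
  ... | inj₂ (_ , here refl) = inj₂ (h p p∈ z∈)
  ... | inj₂ (b , there ∈L)  = inj₂ (b , ∈L)

  covers-∅⇒fin : Reachable 𝓝 C → Covers [] C → _≐_ 𝓝 C (C-fin 𝓝)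
  covers-∅⇒fin rc cov p p∈ with located rc p p∈
  ... | z , eq , _ with cov p p∈ z (singleton-∋ eq)
  ...   | inj₁ refl = eq

  enabled-transfer : ∀ {y a} → Closing ((y , a) ∷ L) → ¬ Occurs y L → AgreeOnEnabled F G →
    Reachable 𝓝 G → Covers ((y , a) ∷ L) G → Enabled 𝓝 F y → Enabled 𝓝 G y
  enabled-transfer {y = y} c@(l ∷ _) y∉L h rg cov en =
    let q , q∈ , eq = h y (Leads.nonfinal l) en
    in  occupied⇒enabled rg c y∉L cov (dom⊆Proc y (proj₁ en) q∈) (subst (y ∈_) eq (proj₂ en q q∈))

  ≐-from-covers : Closing L → Reachable 𝓝 F → Reachable 𝓝 G → Covers L F → Covers L G →
    AgreeOnEnabled F G → AgreeOnEnabled G F → _≐_ 𝓝 F G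
  ≐-from-covers [] rf rg covF covG hF hG =
    ≐-trans (covers-∅⇒fin rf covF) (≐-sym (covers-∅⇒fin rg covG))
  ≐-from-covers {L = (y , a) ∷ L} {F} {G} cl@(l ∷ c) rf rg covF covG hF hG with occurs? y L
  ... | yes y∈L = ≐-from-covers c rf rg
    (covers-tail (λ _ _ _ → y∈L) covF) (covers-tail (λ _ _ _ → y∈L) covG) hF hG
  ... | no y∉L with enabled? F (Leads.node l)
  -- If `y` were occupied in `G`, it would be enabled there and, by agreement, in `F`. So it is
  -- occupied on neither side, and the head covers nothing.
  ...   | no ¬en = ≐-from-covers c rf rg
    (covers-tail (λ p p∈ y∈ → contradiction (occupied⇒enabled rf cl y∉L covF p∈ y∈) ¬en) covF)
    (covers-tail (λ p p∈ y∈ → contradiction (enabled-transfer cl y∉L hG rf covF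
      (occupied⇒enabled rg cl y∉L covG p∈ y∈)) ¬en) covG)
    hF hG
  ...   | yes enF = F≐G
    where
    enG = enabled-transfer cl y∉L hF rg covG enF
    s = proj₂ (fire enF (Leads.outcome l))
    t = proj₂ (fire enG (Leads.outcome l))
    rest = ≐-from-covers c (reachable-step rf s) (reachable-step rg t)
      (covers-step rf l s covF) (covers-step rg l t covG) (agree-step hF s t) (agree-step hG t s)
    -- The induction compares the configurations after firing. Equality is pulled back: the
    -- processes of `y` wait at `y` on both sides, the others did not move.
    F≐G : _≐_ 𝓝 F G
    F≐G p p∈ with p ∈? dom y
    ... | yes p∈y = trans (enabled-at rf enF p∈y) (sym (enabled-at rg enG p∈y))
    ... | no  p∉y = trans (sym (kept s p p∈ p∉y)) (trans (rest p p∈) (kept t p p∈ p∉y))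

  agree⇒≐ : Reachable 𝓝 F → Reachable 𝓝 G → AgreeOnEnabled F G → AgreeOnEnabled G F → _≐_ 𝓝 F G
  agree⇒≐ rf rg with fin-free-completion rf | fin-free-completion rg
  ... | w , r , nf | v , t , ng = ≐-from-covers
    (closing-++ (completion-closing rf r nf) (completion-closing rg t ng)) rf rg
    (λ p p∈ z z∈ → Sum.map₂ (λ (b , i) → b , ∈-++⁺ˡ i) (completion-covers rf r p p∈ z z∈))
    (λ p p∈ z z∈ → Sum.map₂ (λ (b , i) → b , ∈-++⁺ʳ w i) (completion-covers rg t p p∈ z z∈))

-- Extending n-runs to F(n).

module Restriction {P K : ℕ} {R : Set} (𝓝 : Diagram P K R)
  (negotiation : IsNegotiation 𝓝) (deterministic : Deterministic 𝓝) (sound : Sound 𝓝)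
  (n : Fin K) (I F : Config 𝓝) (isI : IsI 𝓝 n I) (isF : IsF 𝓝 n I F) where
  open Diagram 𝓝
  open IsNegotiation negotiation
  open SoundDeterministic 𝓝 negotiation deterministic sound
  open Step using (enabled; outcome; moved; kept)
  open IsI isI
  open IsF isF

  𝓜 : Diagram P (suc K) R
  𝓜 = restrict 𝓝 n I F

  n-node : Node n
  n-node = proj₁ enables-n

  private
    variable
      C D : Config 𝓝
      u : List (Location 𝓝)

  reachable-F : Reachable 𝓝 F
  reachable-F = let _ , _ , r = reached in reachable-run reachable r

  -- For `n ≡ fin` every domain is included in `dom n`, so `maximal` would forbid `F` to enable
  -- anything. But a completion of `F` is empty, and `fin` is enabled, or starts with an enabled
  -- node.
  n≢fin : n ≢ fin
  n≢fin refl with completion reachable-F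
  ... | _ , [] e  = maximal fin (fin-node , λ p p∈ → singleton-∋ (e p (dom⊆Proc fin fin-node p∈)))
                      (inj₂ refl) (λ p∈ → p∈)
  ... | _ , s ∷ _ = maximal _ (enabled s) (inj₂ refl)
    (λ {p} p∈ → subst (p ∈_) (sym dom-fin) (dom⊆Proc _ (proj₁ (enabled s)) p∈))

  nseq-outside : ∀ {q} → q ∈ Proc → q ∉ dom n → NSequence 𝓝 n u → Run 𝓝 C u D → C q ≡ D q
  nseq-outside q∈ q∉ us r = unmoved q∈ (All.map (λ sub q∈x → q∉ (sub q∈x)) us) r

  -- Greedily firing those entries of a completion whose domains lie inside `dom n` ends in some
  -- `F′`. Every non-final node enabled in `F′` or `F` has a process outside `dom n`. N-sequences
  -- never move such processes, so `F′` and `F` agree on them and `agree⇒≐` applies.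
  extends-to-F : NSequence 𝓝 n u → Run 𝓝 I u C →
    ∃ λ v → NSequence 𝓝 n v × Run 𝓝 C v F × All (λ ℓ → proj₁ ℓ ≢ fin) v
  extends-to-F {C = C} us r =
    v , vs , run-target t F′≐F , All.map (λ (_ , ∈w) → closing-nonfinal closing ∈w) v∈
    where
    rc = reachable-run reachable r
    w-completion = fin-free-completion rc
    toward-fin = proj₁ (proj₂ w-completion)
    closing = completion-closing rc toward-fin (proj₂ (proj₂ w-completion))
    covered : ∀ z → z ≢ fin → dom z ⊆ dom n → Enabled 𝓝 C z → Occurs z (proj₁ w-completion)
    covered z ≢fin _ (nz , en) with dom-nonempty z nz
    ... | q , q∈ with completion-covers rc toward-fin q (dom⊆Proc z nz q∈) z (en q q∈)
    ...   | inj₁ eq = contradiction eq ≢fin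
    ...   | inj₂ o  = o
    greedy-run = greedy (λ z → dom z ⊆? dom n) closing rc covered
    v    = proj₁ greedy-run
    F′   = proj₁ (proj₂ greedy-run)
    t    = proj₁ (proj₂ (proj₂ greedy-run))
    v∈   = proj₁ (proj₂ (proj₂ (proj₂ greedy-run)))
    stop = proj₂ (proj₂ (proj₂ (proj₂ greedy-run)))
    vs : NSequence 𝓝 n v
    vs = All.map proj₁ v∈
    agree-outside : ∀ q → q ∈ Proc → q ∉ dom n → F′ q ≡ F q
    agree-outside q q∈ q∉ =
      let _ , us₀ , r₀ = reached
      in  trans (sym (trans (nseq-outside q∈ q∉ us r) (nseq-outside q∈ q∉ vs t)))
                (nseq-outside q∈ q∉ us₀ r₀)
    F′≐F : _≐_ 𝓝 F′ F
    F′≐F = agree⇒≐ (reachable-run rc t) reachable-F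
      (λ z ≢fin en → let q , q∈z , q∉ = ⊈⇒witness {S = dom z} (λ sub → stop z ≢fin sub en)
                     in  q , q∈z , agree-outside q (dom⊆Proc z (proj₁ en) q∈z) q∉)
      (λ z ≢fin en → let q , q∈z , q∉ = ⊈⇒witness {S = dom z} (maximal z en (inj₁ ≢fin))
                     in  q , q∈z , sym (agree-outside q (dom⊆Proc z (proj₁ en) q∈z) q∉))

  -- Nodes fired in n-runs are not of the form F(n)(p).

  -- `fin` is excluded because `inner≢F` can fail for it: if `dom n ≡ Proc`, an n-run may enable
  -- `fin` while F(n) is `C-fin`.
  record InnerNode (m : Fin K) : Set where
    constructor innerNode
    field
      {word}   : List (Location 𝓝)
      {config} : Config 𝓝
      nonfinal : m ≢ fin
      dom⊆     : dom m ⊆ dom n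
      word-n   : NSequence 𝓝 n word
      run      : Run 𝓝 I word config
      enables  : Enabled 𝓝 config m

  split-at : ∀ {z b w} → NSequence 𝓝 n u → NSequence 𝓝 n w → Run 𝓝 I u C → Run 𝓝 C w D →
    (z , b) ∈ˡ w → z ≢ fin → InnerNode z
  split-at us (sub ∷ ws) r (s ∷ t) (here refl) ≢fin = innerNode ≢fin sub us r (enabled s)
  split-at us (sub ∷ ws) r (s ∷ t) (there i)   ≢fin =
    split-at (++⁺ us (sub ∷ [])) ws (r ++ʳ single s) t i ≢fin

  -- In an extension of the n-run to `F` the process `p` has to leave `z`, which requires firing
  -- `z`.
  exits-through-inner : ∀ {p z} → NSequence 𝓝 n u → Run 𝓝 I u C → p ∈ Proc → C p ≡ ⁅ z ⁆ →
    F p ≢ ⁅ z ⁆ → InnerNode z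
  exits-through-inner us r p∈ eq ne =
    let v , vs , t , nonfin = extends-to-F us r
        b , ∈v = left⇒occurs p∈ eq ne t
    in  split-at us vs r t ∈v (All.lookup nonfin ∈v)

  module _ {p m} (p∈m : p ∈ dom m) (inner-m : InnerNode m) (Fp≡m : F p ≡ ⁅ m ⁆) where

    inner-successor : ∀ {x a z} → InnerNode x → Out x a → p ∈ dom x → δ x a p ≡ ⁅ z ⁆ → InnerNode z
    inner-successor {x} {a} {z} (innerNode _ sub us r en) o p∈x eq with F p ≟ˢ ⁅ z ⁆
    -- Only here does the assumption on `F p` enter: `z` is then `m`, which is inner. Without it `p`
    -- could leave the inner nodes through `F p`.
    ... | yes Fp≡z = subst InnerNode (∈-singleton Fp≡z (singleton-∋ Fp≡m)) inner-m
    ... | no  Fp≢z =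
      let _ , s = fire en o
      in  exits-through-inner (++⁺ us (sub ∷ [])) (r ++ʳ single s)
            (dom⊆Proc x (proj₁ en) p∈x) (trans (moved s p p∈x) eq) Fp≢z

    inner-forever : ∀ {z w} → p ∈ Proc → Reachable 𝓝 C → InnerNode z → C p ≡ ⁅ z ⁆ →
      Run 𝓝 C w D → ∃ λ y → InnerNode y × D p ≡ ⁅ y ⁆
    inner-forever p∈ rc inner eq ([] e) = _ , inner , trans (sym (e p p∈)) eq
    inner-forever {w = (x , a) ∷ w} p∈ rc inner eq (s ∷ r) with p ∈? dom x
    ... | no  p∉x = inner-forever p∈ (reachable-step rc s) inner (trans (kept s p p∈ p∉x) eq) r
    ... | yes p∈x with refl ← ∈-singleton eq (proj₂ (enabled s) p p∈x)
                     | y , eq′ , _ ← located (reachable-step rc s) p p∈ =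
      inner-forever p∈ (reachable-step rc s)
        (inner-successor inner (outcome s) p∈x (trans (sym (moved s p p∈x)) eq′)) eq′ r

  -- Otherwise `p` would meet only inner nodes along a completion, yet it ends at `fin`, which is
  -- not inner.
  inner≢F : ∀ {p m} → p ∈ dom m → InnerNode m → F p ≢ ⁅ m ⁆
  inner≢F {p} {m} p∈ inner@(innerNode _ _ _ r en) Fp≡m =
    let rc = reachable-run reachable r
        p∈Proc = dom⊆Proc m (proj₁ en) p∈
        y , inner-y , eq = inner-forever p∈ inner Fp≡m p∈Proc rc inner (enabled-at rc en p∈)
                             (proj₂ (completion rc))
    in  InnerNode.nonfinal inner-y (∈-singleton (sym eq) (x∈⁅x⁆ y))

  -- The restricted diagram is a deterministic negotiation diagram.

  -- This is the redirection in the transition function of `restrict`, stated for any set so that it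
  -- applies to configurations too.
  collapse : Fin P → Subset K → Subset (suc K)
  collapse p S = if does (S ≟ˢ F p) then ⁅ zero ⁆ else outside ∷ S

  collapse-∋⁻ : ∀ p S {m} → suc m ∈ collapse p S → m ∈ S × S ≢ F p
  collapse-∋⁻ p S m∈ with S ≟ˢ F p | m∈
  ... | yes _ | there m∈∅ = contradiction m∈∅ ∉⊥
  ... | no ne | there m∈S = m∈S , ne

  collapse-≢ : ∀ p S → S ≢ F p → collapse p S ≡ outside ∷ S
  collapse-≢ p S ne with S ≟ˢ F p
  ... | yes eq = contradiction eq ne
  ... | no _   = refl

  collapse-F : ∀ p → collapse p (F p) ≡ ⁅ zero ⁆
  collapse-F p with F p ≟ˢ F p
  ... | yes _ = refl
  ... | no ne = contradiction refl ne

  -- Unlike in `InnerNode`, `x` may be `fin`, whose outcomes may also appear in n-sequences leading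
  -- to `F`.
  record InnerStep (x : Fin K) (a : R) : Set where
    constructor innerStep
    field
      {before} : List (Location 𝓝)
      {source} {target} : Config 𝓝
      before-n : NSequence 𝓝 n before
      dom⊆     : dom x ⊆ dom n
      leading  : Run 𝓝 I before source
      step     : Step 𝓝 source (x , a) target

  appears⇒step : ∀ {x a} → Appears 𝓝 n I F (x , a) → InnerStep x a
  appears⇒step (_ , us , r , ∈u) = go [] us ([] (λ _ _ → refl)) r ∈u
    where
    go : ∀ {x a w} → NSequence 𝓝 n u → NSequence 𝓝 n w → Run 𝓝 I u C → Run 𝓝 C w F →
      (x , a) ∈ˡ w → InnerStep x a
    go us (sub ∷ ws) r (s ∷ t) (here refl) = innerStep us sub r s
    go us (sub ∷ ws) r (s ∷ t) (there i)   =
      go (++⁺ us (sub ∷ [])) ws (r ++ʳ single s) t i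

  -- Any outcome of `m` serves: the n-run that fires it still extends to `F`.
  inner-appears : ∀ {m} → InnerNode m → ∃ λ a → Appears 𝓝 n I F (m , a)
  inner-appears {m} (innerNode {u} nonfin sub us r en) =
    let a , o = has-outcome m (proj₁ en) nonfin
        _ , s = fire en o
        r′ = r ++ʳ single s
        v , vs , t , _ = extends-to-F (++⁺ us (sub ∷ [])) r′
    in  a , _ , ++⁺ (++⁺ us (sub ∷ [])) vs , r′ ++ʳ t , ∈-++⁺ˡ (∈-++⁺ʳ u (here refl))

  inner-n : InnerNode n
  inner-n = innerNode n≢fin (λ p∈ → p∈) [] ([] (λ _ _ → refl)) enables-n

  restrict-negotiation : IsNegotiation 𝓜
  restrict-negotiation = record
    { init-node    = inner-appears inner-n
    ; fin-node     = tt
    ; dom-init     = refl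
    ; dom-fin      = refl
    ; dom⊆Proc     = λ { zero _ p∈ → p∈ ; (suc m) (_ , app) → InnerStep.dom⊆ (appears⇒step app) }
    ; dom-nonempty = λ { zero _ → dom-nonempty n n-node
                       ; (suc m) (_ , app) →
                           dom-nonempty m (proj₁ (enabled (InnerStep.step (appears⇒step app)))) }
    ; has-outcome  = λ { zero _ ≢fin → contradiction refl ≢fin ; (suc m) nm _ → nm }
    ; δ-valid      = λ { (suc m) a p _ app p∈ z z∈ → valid m a p (appears⇒step app) p∈ z z∈ }
    }
    where
    valid : ∀ m a p → InnerStep m a → p ∈ dom m → ∀ z → z ∈ Diagram.δ 𝓜 (suc m) a p →
      Diagram.Node 𝓜 z × p ∈ Diagram.dom 𝓜 z
    valid m a p st p∈ zero    _  = tt , InnerStep.dom⊆ st p∈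
    valid m a p (innerStep us sub r s) p∈ (suc z) z∈ =
      let z∈δ , ≢F = collapse-∋⁻ p (δ m a p) z∈
          r′ = r ++ʳ single s
          p∈Proc = dom⊆Proc m (proj₁ (enabled s)) p∈
          eq , nz , p∈z = at (reachable-run reachable r′) p∈Proc (subst (z ∈_) (sym (moved s p p∈)) z∈δ)
      -- A target that was not redirected differs from `F p`, so `p` must leave it on the way to
      -- `F`.
      in  inner-appears (exits-through-inner (++⁺ us (sub ∷ [])) r′ p∈Proc eq
            (λ Fp≡z → ≢F (trans (sym (moved s p p∈)) (trans eq (sym Fp≡z))))) , p∈z

  restrict-deterministic : Deterministic 𝓜
  restrict-deterministic (suc m) a p _ app p∈ with δ m a p ≟ˢ F p
  ... | yes _ = inj₂ (zero , refl)
  ... | no _ with s ← InnerStep.step (appears⇒step app)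
      with deterministic m a p (proj₁ (enabled s)) (outcome s) p∈
  ...   | inj₁ eq       = inj₁ (cong (outside ∷_) eq)
  ...   | inj₂ (z , eq) = inj₂ (suc z , cong (outside ∷_) eq)

  -- Simulation between n-runs and runs of the restriction; soundness.

  Simulates : Config 𝓜 → Config 𝓝 → Set
  Simulates M C = ∀ p → p ∈ dom n → M p ≡ collapse p (C p)

  -- `n` itself is inner, so by `inner≢F` no initial position is collapsed.
  init-simulates : Simulates (C-init 𝓜) I
  init-simulates p p∈ = sym (trans (cong (collapse p) Ip≡n)
      (collapse-≢ p ⁅ n ⁆ (λ eq → inner≢F p∈ inner-n (sym eq))))
    where Ip≡n = enabled-at reachable enables-n p∈

  simulates-step : ∀ {M M′ x a} → dom x ⊆ dom n → Simulates M C → Step 𝓝 C (x , a) D →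
    Step 𝓜 M (suc x , a) M′ → Simulates M′ D
  simulates-step {x = x} sub sim s t p p∈ with p ∈? dom x
  ... | yes p∈x = trans (moved t p p∈x) (cong (collapse p) (sym (moved s p p∈x)))
  ... | no  p∉x = trans (kept t p p∈ p∉x)
      (trans (sim p p∈) (cong (collapse p) (sym (kept s p (dom⊆Proc n n-node p∈) p∉x))))

  simulate : ∀ {M M′ w} → NSequence 𝓝 n u → Run 𝓝 I u C → Simulates M C → Run 𝓜 M w M′ →
    ∃₂ λ v D → NSequence 𝓝 n v × Run 𝓝 I v D × Simulates M′ D
  simulate us r sim ([] e) = _ , _ , us , r , λ p p∈ → trans (sym (e p p∈)) (sim p p∈)
  simulate {w = (zero , a) ∷ w} us r sim (t ∷ _) = contradiction (outcome t) λ ()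
  simulate {C = C} {M = M} {w = (suc x , a) ∷ w} us r sim (t ∷ ts) =
    simulate (++⁺ us (sub ∷ [])) (r ++ʳ single s) (simulates-step sub sim s t) ts
    where
    st = appears⇒step (outcome t)
    sub : dom x ⊆ dom n
    sub = InnerStep.dom⊆ st
    enC : Enabled 𝓝 C x
    -- `st` may stem from a different n-run; it only certifies that `x` is a node with outcome `a`.
    -- Enabledness in `C` holds because collapsing adds no node of `𝓝`.
    enC = proj₁ (enabled (InnerStep.step st)) , λ p p∈ →
      proj₁ (collapse-∋⁻ p (C p) (subst (suc x ∈_) (sim p (sub p∈)) (proj₂ (enabled t) p p∈)))
    s = proj₂ (fire enC (outcome (InnerStep.step st)))

  -- The whole n-run ends in `F`, so each of its locations appears and is available in `𝓜`. At its
  -- end every position equals `F p` and collapses to the new final node.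
  lift : ∀ {M v} → NSequence 𝓝 n u → Run 𝓝 I u C → Simulates M C →
    NSequence 𝓝 n v → All (λ ℓ → proj₁ ℓ ≢ fin) v → Run 𝓝 C v F →
    ∃ λ w → Run 𝓜 M w (C-fin 𝓜)
  lift us r sim [] [] ([] e) = [] , [] λ p p∈ → trans (sim p p∈)
    (trans (cong (collapse p) (e p (dom⊆Proc n n-node p∈))) (collapse-F p))
  lift {u = u} {C = C} {M = M} {v = (x , a) ∷ v} us r sim (sub ∷ vs) (nonfin ∷ nonfins) (s ∷ ts) =
    let w , rest = lift (++⁺ us (sub ∷ [])) (r ++ʳ single s)
                     (simulates-step sub sim s t) vs nonfins ts
    in  (suc x , a) ∷ w , t ∷ rest
    where
    app : Appears 𝓝 n I F (x , a)
    app = u ++ (x , a) ∷ v , ++⁺ us (sub ∷ vs) , r ++ʳ (s ∷ ts) , ∈-++⁺ʳ u (here refl)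
    enM : Enabled 𝓜 M (suc x)
    enM = (a , app) , λ p p∈ →
      let Cp≡x = enabled-at (reachable-run reachable r) (enabled s) p∈
          -- A node about to be fired is inner, so its processes have not been redirected.
          ne   = λ Cp≡F → inner≢F p∈ (innerNode nonfin sub us r (enabled s)) (trans (sym Cp≡F) Cp≡x)
      in  subst (suc x ∈_) (sym (trans (sim p (sub p∈)) (collapse-≢ p (C p) ne)))
            (there (proj₂ (enabled s) p p∈))
    t = proj₂ (Runs.fire 𝓜 restrict-negotiation enM app)

  restrict-sound : Sound 𝓜
  restrict-sound w M run =
    let u , C , us , r , sim = simulate [] ([] (λ _ _ → refl)) init-simulates run
        v , vs , t , nonfin = extends-to-F us r
        w′ , run′ = lift us r sim vs nonfin t
    in  w′ , Runs._++ʳ_ 𝓜 restrict-negotiation run run′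

lemma5 : ∀ {P K : ℕ} {R : Set} (𝓝 : Diagram P K R) →
    IsNegotiation 𝓝 → Deterministic 𝓝 → Sound 𝓝 →
    ∀ (n : Fin K) → ReachableNode 𝓝 n →
    ∀ (I F : Config 𝓝) → IsI 𝓝 n I → IsF 𝓝 n I F →
    IsNegotiation (restrict 𝓝 n I F) ×
    Deterministic (restrict 𝓝 n I F) ×
    Sound (restrict 𝓝 n I F)
lemma5 𝓝 negotiation deterministic sound n _ I F isI isF =
  restrict-negotiation , restrict-deterministic , restrict-sound
  where open Restriction 𝓝 negotiation deterministic sound n I F isI isF
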